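{- Let $G=(X,E)$ be a connected $P_4$-free graph of any cardinality. If there exists $x\in X$ such that the induced subgraph $G_{\restriction \mathrm{inc}(x)}$ has finitely many connected components, then the complement graph $\overline{G}$ is not connected.
   Context: Graphs are undirected, simple, without loops, and not necessarily finite: $G=(X,E)$ with $E\subseteq [X]^2$, the set of $2$-element subsets of $X$. The complement $\overline{G}$ has vertex set $X$ and edge set $[X]^2\setminus E$. For $A\subseteq X$, $G_{\restriction A}:=(A,E\cap[A]^2)$ is the subgraph induced by $G$ on $A$. $P_4$ is the path on four vertices $1,2,3,4$ with edges $\{1,2\},\{2,3\},\{3,4\}$; a graph is $P_4$-free if it has no $P_4$ as an induced subgraph. For $x\in X$, let $N(x):=\{y\in X:\{x,y\}\in E\}$ and $\mathrm{inc}(x):=X\setminus(N(x)\cup\{x\})$.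
   Formalization: The formal theorem assumes in addition that the graph has at least two distinct vertices; the one-vertex graph is connected and P_4-free, inc(x) is empty, and its complement is connected, so the claim fails for it as literally stated. -}

module Defs where

open import Data.Fin using (Fin; toℕ)
open import Data.Nat using (suc)
open import Data.Nat.Properties using (1+n≢n)
open import Data.Product using (∃-syntax; Σ-syntax; _×_; _,_)
open import Data.Refinement using (Refinement; value)
open import Data.Sum using (_⊎_; inj₁; inj₂; swap)
open import Function.Bundles using (_⇔_; Surjection)
open import Function.Definitions using (Injective)
open import Level using (Level; 0ℓ; _⊔_) renaming (suc to lsuc)
open import Relation.Binary.Bundles using (Setoid)
open import Relation.Binary.Construct.Closure.ReflexiveTransitive
  using (Star; ε; _◅◅_; reverse)
open import Relation.Binary.Core using (Rel)
open import Relation.Binary.Definitions using (Symmetric; Irreflexive)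
open import Relation.Binary.PropositionalEquality
  using (_≡_; _≢_; refl; sym; cong; setoid; ≢-sym)
open import Relation.Nullary using (¬_)
open import Relation.Unary using (Pred; ∁; _∪_; ｛_｝)

private
  variable
    a b p ℓ ℓ′ : Level

-- An edge set E ⊆ [X]² is given as a symmetric irreflexive relation on X.
-- Neither equality on X nor adjacency is assumed decidable.
record Graph (X : Set a) (ℓ : Level) : Set (a ⊔ lsuc ℓ) where
  field
    Edge        : Rel X ℓ
    Edge-sym    : Symmetric Edge
    Edge-irrefl : Irreflexive _≡_ Edge

open Graph public

complement : {X : Set a} → Graph X ℓ → Graph X (a ⊔ ℓ)
complement G = record
  { Edge        = λ x y → x ≢ y × ¬ Edge G x y
  ; Edge-sym    = λ (x≢y , ¬e) → ≢-sym x≢y , λ e → ¬e (Edge-sym G e)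
  ; Edge-irrefl = λ x≡y (x≢y , _) → x≢y x≡y
  }

-- The vertices are the elements of A with an irrelevant membership proof:
-- with Σ X A, a single element of A could yield several vertices, lying in
-- different connected components.
induced : {X : Set a} → Graph X ℓ → (A : Pred X p) → Graph (Refinement X A) ℓ
induced G A = record
  { Edge        = λ u v → Edge G (value u) (value v)
  ; Edge-sym    = Edge-sym G
  ; Edge-irrefl = λ u≡v → Edge-irrefl G (cong value u≡v)
  }

-- H is isomorphic to an induced subgraph of G.
_IsInducedIn_ : {Y : Set b} {X : Set a} → Graph Y ℓ′ → Graph X ℓ → Set (a ⊔ b ⊔ ℓ ⊔ ℓ′)
_IsInducedIn_ {Y = Y} {X = X} H G =
  Σ[ f ∈ (Y → X) ] Injective _≡_ _≡_ f × (∀ i j → Edge H i j ⇔ Edge G (f i) (f j))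

-- The vertices 1, 2, 3, 4 of the path are numbered 0, 1, 2, 3 here.
P₄ : Graph (Fin 4) 0ℓ
P₄ = record
  { Edge        = λ i j → toℕ j ≡ suc (toℕ i) ⊎ toℕ i ≡ suc (toℕ j)
  ; Edge-sym    = swap
  ; Edge-irrefl = λ { refl (inj₁ e) → 1+n≢n (sym e) ; refl (inj₂ e) → 1+n≢n (sym e) }
  }

P₄-free : {X : Set a} → Graph X ℓ → Set (a ⊔ ℓ)
P₄-free G = ¬ (P₄ IsInducedIn G)

Walk : {X : Set a} → Graph X ℓ → Rel X (a ⊔ ℓ)
Walk G = Star (Edge G)

-- This does not exclude the graph without vertices.
Connected : {X : Set a} → Graph X ℓ → Set (a ⊔ ℓ)
Connected G = ∀ x y → Walk G x y

-- The set of connected components, as the quotient of the vertex set by the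
-- relation "joined by a walk".
Components : {X : Set a} → Graph X ℓ → Setoid a (a ⊔ ℓ)
Components {X = X} G = record
  { Carrier       = X
  ; _≈_           = Walk G
  ; isEquivalence = record
    { refl  = ε
    ; sym   = reverse (Edge-sym G)
    ; trans = _◅◅_
    }
  }

-- A finite set is one listed, possibly with repetitions, by some Fin n.
-- A bijection would moreover make "joined by a walk" decidable.
FinitelyManyComponents : {X : Set a} → Graph X ℓ → Set (a ⊔ ℓ)
FinitelyManyComponents G = ∃[ n ] Surjection (setoid (Fin n)) (Components G)

N : {X : Set a} → Graph X ℓ → X → Pred X ℓ
N G x y = Edge G x y

inc : {X : Set a} → Graph X ℓ → X → Pred X (a ⊔ ℓ)
inc G x = ∁ (N G x ∪ ｛ x ｝)

{-# OPTIONS --safe #-}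
-- Let A be the set of the y ∈ N(x) adjacent to every vertex of inc(x).  If
-- y ∈ A and z ∉ A were non-adjacent, then z ∈ N(x), and z − x − y − c would be
-- an induced P₄ for any c ∈ inc(x) with z ≁ c.  So A is closed under adjacency
-- in the complement, and as x ∉ A it remains to see that A is non-empty.
--
-- Every vertex of inc(x) has a neighbour in N(x), and the neighbourhoods in
-- N(x) of the vertices of inc(x) form a chain and are constant on the
-- components of inc(x).  With finitely many components, the smallest of these
-- neighbourhoods exists, is non-empty and is contained in A.
--
-- Since the conclusion is a negation, membership and adjacency are handled up
-- to double negation; only finitely many case distinctions are ever combined.
module Submission where

open import Defs
open import Data.Empty using (⊥; ⊥-elim; ⊥-elim-irr)
open import Data.Fin using (Fin; zero; suc)
open import Data.Irrelevant using () renaming ([_] to irrelevant)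
open import Data.Nat using (zero; suc)
open import Data.Product using (∃-syntax; Σ-syntax; _×_; _,_; proj₁; proj₂)
open import Data.Refinement using (Refinement; value; _,_)
open import Data.Sum using (_⊎_; inj₁; inj₂; [_,_])
open import Function.Base using (_∘_)
open import Function.Bundles using (Surjection; mk⇔)
open import Function.Definitions using (Injective)
open import Level using (Level; _⊔_)
open import Relation.Binary.Construct.Closure.ReflexiveTransitive using (ε; _◅_)
open import Relation.Binary.PropositionalEquality using (_≡_; _≢_; refl; sym; subst)
open import Relation.Nullary using (¬_)

private
  variable
    a ℓ : Level
    X   : Set a

-- Distinctness need not be assumed: no two vertices of P₄ have the same
-- neighbours.
no-induced-path : (G : Graph X ℓ) → P₄-free G → ∀ {p q r s} →
  Edge G p q → Edge G q r → Edge G r s →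
  ¬ Edge G p r → ¬ Edge G p s → ¬ Edge G q s → ⊥
no-induced-path {X = X} G P₄∌ {p} {q} {r} {s} pq qr rs p≁r p≁s q≁s =
  P₄∌ (f , injective , λ i j → mk⇔ (edge⁺ i j) (edge⁻ i j))
  where
  _~_ = Edge G

  ~-sym : ∀ {u v} → u ~ v → v ~ u
  ~-sym = Edge-sym G

  f : Fin 4 → X
  f zero                   = p
  f (suc zero)             = q
  f (suc (suc zero))       = r
  f (suc (suc (suc zero))) = s

  p≢q : p ≢ q
  p≢q eq = Edge-irrefl G eq pq
  p≢r : p ≢ r
  p≢r eq = p≁s (subst (_~ s) (sym eq) rs)
  p≢s : p ≢ s
  p≢s eq = q≁s (subst (q ~_) eq (~-sym pq))
  q≢r : q ≢ r
  q≢r eq = Edge-irrefl G eq qr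
  q≢s : q ≢ s
  q≢s eq = p≁s (subst (p ~_) eq pq)
  r≢s : r ≢ s
  r≢s eq = Edge-irrefl G eq rs

  injective : Injective _≡_ _≡_ f
  injective {zero}                 {zero}                 _  = refl
  injective {zero}                 {suc zero}             eq = ⊥-elim (p≢q eq)
  injective {zero}                 {suc (suc zero)}       eq = ⊥-elim (p≢r eq)
  injective {zero}                 {suc (suc (suc zero))} eq = ⊥-elim (p≢s eq)
  injective {suc zero}             {zero}                 eq = ⊥-elim (p≢q (sym eq))
  injective {suc zero}             {suc zero}             _  = refl
  injective {suc zero}             {suc (suc zero)}       eq = ⊥-elim (q≢r eq)
  injective {suc zero}             {suc (suc (suc zero))} eq = ⊥-elim (q≢s eq)
  injective {suc (suc zero)}       {zero}                 eq = ⊥-elim (p≢r (sym eq))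
  injective {suc (suc zero)}       {suc zero}             eq = ⊥-elim (q≢r (sym eq))
  injective {suc (suc zero)}       {suc (suc zero)}       _  = refl
  injective {suc (suc zero)}       {suc (suc (suc zero))} eq = ⊥-elim (r≢s eq)
  injective {suc (suc (suc zero))} {zero}                 eq = ⊥-elim (p≢s (sym eq))
  injective {suc (suc (suc zero))} {suc zero}             eq = ⊥-elim (q≢s (sym eq))
  injective {suc (suc (suc zero))} {suc (suc zero)}       eq = ⊥-elim (r≢s (sym eq))
  injective {suc (suc (suc zero))} {suc (suc (suc zero))} _  = refl

  edge⁺ : ∀ i j → Edge P₄ i j → f i ~ f j
  edge⁺ zero                   (suc zero)             _ = pq
  edge⁺ (suc zero)             (suc (suc zero))       _ = qr
  edge⁺ (suc (suc zero))       (suc (suc (suc zero))) _ = rs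
  edge⁺ (suc zero)             zero                   _ = ~-sym pq
  edge⁺ (suc (suc zero))       (suc zero)             _ = ~-sym qr
  edge⁺ (suc (suc (suc zero))) (suc (suc zero))       _ = ~-sym rs
  edge⁺ zero                   zero                   = [ (λ ()) , (λ ()) ]
  edge⁺ zero                   (suc (suc zero))       = [ (λ ()) , (λ ()) ]
  edge⁺ zero                   (suc (suc (suc zero))) = [ (λ ()) , (λ ()) ]
  edge⁺ (suc zero)             (suc zero)             = [ (λ ()) , (λ ()) ]
  edge⁺ (suc zero)             (suc (suc (suc zero))) = [ (λ ()) , (λ ()) ]
  edge⁺ (suc (suc zero))       zero                   = [ (λ ()) , (λ ()) ]
  edge⁺ (suc (suc zero))       (suc (suc zero))       = [ (λ ()) , (λ ()) ]
  edge⁺ (suc (suc (suc zero))) zero                   = [ (λ ()) , (λ ()) ]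
  edge⁺ (suc (suc (suc zero))) (suc zero)             = [ (λ ()) , (λ ()) ]
  edge⁺ (suc (suc (suc zero))) (suc (suc (suc zero))) = [ (λ ()) , (λ ()) ]

  edge⁻ : ∀ i j → f i ~ f j → Edge P₄ i j
  edge⁻ zero                   (suc zero)             _ = inj₁ refl
  edge⁻ (suc zero)             (suc (suc zero))       _ = inj₁ refl
  edge⁻ (suc (suc zero))       (suc (suc (suc zero))) _ = inj₁ refl
  edge⁻ (suc zero)             zero                   _ = inj₂ refl
  edge⁻ (suc (suc zero))       (suc zero)             _ = inj₂ refl
  edge⁻ (suc (suc (suc zero))) (suc (suc zero))       _ = inj₂ refl
  edge⁻ zero                   zero                   e = ⊥-elim (Edge-irrefl G refl e)
  edge⁻ zero                   (suc (suc zero))       e = ⊥-elim (p≁r e)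
  edge⁻ zero                   (suc (suc (suc zero))) e = ⊥-elim (p≁s e)
  edge⁻ (suc zero)             (suc zero)             e = ⊥-elim (Edge-irrefl G refl e)
  edge⁻ (suc zero)             (suc (suc (suc zero))) e = ⊥-elim (q≁s e)
  edge⁻ (suc (suc zero))       zero                   e = ⊥-elim (p≁r (~-sym e))
  edge⁻ (suc (suc zero))       (suc (suc zero))       e = ⊥-elim (Edge-irrefl G refl e)
  edge⁻ (suc (suc (suc zero))) zero                   e = ⊥-elim (p≁s (~-sym e))
  edge⁻ (suc (suc (suc zero))) (suc zero)             e = ⊥-elim (q≁s (~-sym e))
  edge⁻ (suc (suc (suc zero))) (suc (suc (suc zero))) e = ⊥-elim (Edge-irrefl G refl e)

-- At most one of the walks from `x` to `u` and `v` is empty, and the other begins with an edge. The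
-- two distinct vertices rule out the one-vertex graph, which is connected along with its
-- complement.
connected⇒neighbour : (G : Graph X ℓ) → Connected G →
  (Σ[ u ∈ X ] ∃[ v ] u ≢ v) → ∀ x → ∃[ y ] Edge G x y
connected⇒neighbour G conn (u , v , u≢v) x with conn x u | conn x v
... | e ◅ _ | _     = _ , e
... | ε     | e ◅ _ = _ , e
... | ε     | ε     = ⊥-elim (u≢v refl)

-- Membership in inc(x) is a negation, so it can be recovered from its
-- irrelevant proof.
value∈inc : (G : Graph X ℓ) (x : X) (c : Refinement X (inc G x)) → inc G x (value c)
value∈inc G x (c , irrelevant c∈inc) h = ⊥-elim-irr (c∈inc h)

-- Membership in the set A described at the top. Double negation suits the passage along co-edges,
-- where adjacency is only reached by refuting non-adjacency.
FullyJoined : {X : Set a} → Graph X ℓ → X → X → Set (a ⊔ ℓ)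
FullyJoined G x y = ¬ ¬ Edge G x y × (∀ c → inc G x c → ¬ ¬ Edge G y c)

module _ {a ℓ} {X : Set a} (G : Graph X ℓ) (P₄∌ : P₄-free G) (x : X) where

  private
    _~_ = Edge G

    path : ∀ {p q r s} → p ~ q → q ~ r → r ~ s →
      ¬ p ~ r → ¬ p ~ s → ¬ q ~ s → ⊥
    path = no-induced-path G P₄∌

    WithinTwo : X → Set (a ⊔ ℓ)
    WithinTwo z = x ≡ z ⊎ x ~ z ⊎ ∃[ y ] x ~ y × y ~ z

    withinTwo-step : ∀ {u v} → u ~ v → WithinTwo u → ¬ ¬ WithinTwo v
    withinTwo-step uv (inj₁ refl)                 k = k (inj₂ (inj₁ uv))
    withinTwo-step uv (inj₂ (inj₁ xu))            k = k (inj₂ (inj₂ (_ , xu , uv)))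
    withinTwo-step uv (inj₂ (inj₂ (y , xy , yu))) k =
      -- Each chord of x - y - u - v gives a way from `x` to `v` with at most two edges; without
      -- chords this would be an induced P₄.
      path xy yu uv
        (λ xu → k (inj₂ (inj₂ (_ , xu , uv))))
        (λ xv → k (inj₂ (inj₁ xv)))
        (λ yv → k (inj₂ (inj₂ (_ , xy , yv))))

    withinTwo-walk : ∀ {u v} → Walk G u v → WithinTwo u → ¬ ¬ WithinTwo v
    withinTwo-walk ε        d k = k d
    withinTwo-walk (uw ◅ w) d k = withinTwo-step uw d λ d′ → withinTwo-walk w d′ k

  common-neighbour : Connected G → ∀ {c} → inc G x c → ¬ ¬ (∃[ y ] x ~ y × y ~ c)
  common-neighbour conn {c} c∈inc k = withinTwo-walk (conn x c) (inj₁ refl) λ where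
    (inj₁ x≡c)       → c∈inc (inj₂ x≡c)
    (inj₂ (inj₁ xc)) → c∈inc (inj₁ xc)
    (inj₂ (inj₂ h))  → k h

  -- Otherwise x - y - c - d would be an induced P₄.
  adjacent-along-edge : ∀ {y c d} → inc G x c → inc G x d →
    x ~ y → c ~ d → y ~ c → ¬ ¬ y ~ d
  adjacent-along-edge c∈inc d∈inc xy cd yc = path xy yc cd (c∈inc ∘ inj₁) (d∈inc ∘ inj₁)

  adjacent-along-walk : ∀ {y c d} → x ~ y → Walk (induced G (inc G x)) c d →
    y ~ value c → ¬ ¬ y ~ value d
  adjacent-along-walk xy ε yc k = k yc
  adjacent-along-walk xy (_◅_ {i = c} {j = e} ce w) yc k =
    adjacent-along-edge (value∈inc G x c) (value∈inc G x e) xy ce yc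
      λ ye → adjacent-along-walk xy w ye k

  -- Suppose z ≁ c. Then y ~ z, or else c - y - x - z is an induced P₄. Now c - y - z - d is one,
  -- because an edge between `c` and `d` would force y ~ d.
  neighbourhoods-chain : ∀ {c d y z} → inc G x c → inc G x d → x ~ y → x ~ z →
    y ~ c → ¬ y ~ d → z ~ d → ¬ ¬ z ~ c
  neighbourhoods-chain c∈inc d∈inc xy xz yc y≁d zd z≁c =
    path (Edge-sym G yc) (Edge-sym G xy) xz
      (c∈inc ∘ inj₁ ∘ Edge-sym G)
      (z≁c ∘ Edge-sym G)
      λ yz → path (Edge-sym G yc) yz zd
        (z≁c ∘ Edge-sym G)
        (λ cd → adjacent-along-edge c∈inc d∈inc xy cd yc y≁d)
        y≁d

  -- Induction on `n`: a candidate `y` that misses the new vertex is replaced by some `z` adjacent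
  -- to it, and the chain property lets `z` keep the earlier vertices.
  common-neighbour-of-finite : Connected G → (∃[ y ] x ~ y) →
    ∀ n (c : Fin n → X) → (∀ i → inc G x (c i)) →
    ¬ ¬ (∃[ y ] x ~ y × (∀ i → ¬ ¬ y ~ c i))
  -- The initial candidate is any neighbour of `x`; it is also the final one when nothing is listed.
  common-neighbour-of-finite conn (y , xy) zero    c c∈inc k = k (y , xy , λ ())
  common-neighbour-of-finite conn nbr      (suc n) c c∈inc k =
    common-neighbour-of-finite conn nbr n (c ∘ suc) (c∈inc ∘ suc) λ (y , xy , y~c) →
    common-neighbour conn (c∈inc zero) λ (z , xz , zc₀) →
    let
      -- If `y` were adjacent to the new vertex, it would already serve as the witness.
      y≁c₀ : ¬ y ~ c zero
      y≁c₀ yc₀ = k (y , xy , λ { zero ¬yc₀ → ¬yc₀ yc₀ ; (suc i) → y~c i })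
    in k (z , xz , λ where
      zero    z≁c₀ → z≁c₀ zc₀
      (suc i) z≁c  → y~c i λ yc →
        neighbourhoods-chain (c∈inc (suc i)) (c∈inc zero) xy xz yc y≁c₀ zc₀ z≁c)

  fullyJoined-exists : Connected G → (∃[ y ] x ~ y) →
    FinitelyManyComponents (induced G (inc G x)) → ¬ ¬ (∃[ y ] FullyJoined G x y)
  fullyJoined-exists conn nbr (n , components) k =
    common-neighbour-of-finite conn nbr n (value ∘ to) (value∈inc G x ∘ to)
      λ (y , xy , y~c) → k (y , (λ x≁y → x≁y xy) , λ d d∈inc y≁d →
        -- `to i` is a listed vertex in the component of `d`, and `w` leads from it to `d`.
        let i , w = strictlySurjective (d , irrelevant d∈inc)
        in y~c i λ yc → adjacent-along-walk xy w yc y≁d)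
    where open Surjection components using (to; strictlySurjective)

  fullyJoined-co-edge : ∀ {y z} → Edge (complement G) y z →
    FullyJoined G x y → FullyJoined G x z
  fullyJoined-co-edge {y} {z} (_ , y≁z) (x~y , y~inc) = x~z , z~inc
    where
    x~z : ¬ ¬ x ~ z
    -- A non-neighbour `z` of `x` is either in inc(x), hence adjacent to `y`, or equal to `x`, again
    -- adjacent to `y`.
    x~z x≁z = y~inc z
      [ x≁z , (λ { refl → x~y (y≁z ∘ Edge-sym G) }) ]
      y≁z

    z~inc : ∀ c → inc G x c → ¬ ¬ z ~ c
    z~inc c c∈inc z≁c =
      x~z λ xz → x~y λ xy → y~inc c c∈inc λ yc →
      path (Edge-sym G xz) xy yc (y≁z ∘ Edge-sym G) z≁c (c∈inc ∘ inj₁)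

  fullyJoined-co-walk : ∀ {y z} → Walk (complement G) y z →
    FullyJoined G x y → FullyJoined G x z
  fullyJoined-co-walk ε       j = j
  fullyJoined-co-walk (e ◅ w) j = fullyJoined-co-walk w (fullyJoined-co-edge e j)

corollary3 : ∀ {a ℓ : Level} {X : Set a} (G : Graph X ℓ) →
    (Σ[ u ∈ X ] ∃[ v ] u ≢ v) →
    Connected G →
    P₄-free G →
    (∃[ x ] FinitelyManyComponents (induced G (inc G x))) →
    ¬ Connected (complement G)
corollary3 G u≢v conn P₄∌ (x , fin) co-conn =
  fullyJoined-exists G P₄∌ x conn (connected⇒neighbour G conn u≢v x) fin λ (y , j) →
  proj₁ (fullyJoined-co-walk G P₄∌ x (co-conn y x) j) (Edge-irrefl G refl)
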